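{- There is no constant $c>0$ for which any one of the following four inequalities holds for every graph $G$: $$\mathrm{tw}(L(G)) \geq c\,\mathrm{tw}(G)\,\delta(G), \qquad \mathrm{tw}(L(G)) \geq c\,\mathrm{tw}(G)\,d(G),$$ $$\mathrm{pw}(L(G)) \geq c\,\mathrm{pw}(G)\,\delta(G), \qquad \mathrm{pw}(L(G)) \geq c\,\mathrm{pw}(G)\,d(G).$$ That is, for each of these four inequalities and every $c>0$ there is a graph $G$ for which the inequality fails.
   Context: Graphs are finite, simple and undirected, with at least one vertex. $\delta(G)$ is the minimum degree of $G$ and $d(G)=2|E(G)|/|V(G)|$ is its average degree. The line graph $L(G)$ has vertex set $E(G)$, two distinct elements being adjacent if and only if the corresponding edges of $G$ share an endpoint. A tree decomposition of a graph $H$ is a (nonempty) tree $T$ together with a collection of subsets of $V(H)$ (bags) indexed by the nodes of $T$ such that: every vertex of $H$ is in at least one bag; for each vertex $v$ of $H$, the nodes whose bags contain $v$ induce a connected subtree of $T$; and for each edge of $H$ some bag contains both its endpoints. Its width is the size of the largest bag minus 1. The treewidth $\mathrm{tw}(H)$ is the minimum width of a tree decomposition of $H$; the pathwidth $\mathrm{pw}(H)$ is the minimum width over tree decompositions whose tree $T$ is a path. (If $H$ has no vertices, $\mathrm{tw}(H)=\mathrm{pw}(H)=-1$.) To avoid the trivial failure caused by this convention, the graphs $G$ considered are those with at least one edge. -}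

module Defs where

open import Level using (0ℓ)
open import Data.Nat.Base as ℕ using (ℕ; suc; NonZero)
open import Data.Integer.Base as ℤ using (ℤ; +_)
open import Data.Rational.Base as ℚ using (ℚ; _/_)
open import Data.Fin.Base using (Fin; toℕ)
open import Data.Fin.Properties using (_<?_; _≟_)
open import Data.Fin.Permutation using (Permutation′; _⟨$⟩ʳ_)
open import Data.Fin.Subset using (Subset; _∈_; ∣_∣)
open import Data.List.Base
  using (List; _∷_; _∷ʳ_; length; lookup; map; filter; allFin; cartesianProduct)
open import Data.List.Extrema.Nat using (min; max)
open import Data.List.Relation.Unary.Linked using (Linked)
open import Data.List.Relation.Unary.Unique.Propositional using (Unique)
open import Data.Product.Base using (Σ-syntax; ∃₂; ∃-syntax; _×_; _,_)
open import Data.Sum.Base using (_⊎_; inj₁; inj₂)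
open import Function.Bundles using (_⇔_)
open import Relation.Binary.Construct.Closure.ReflexiveTransitive using (Star)
open import Relation.Binary.Core using (Rel)
open import Relation.Binary.Definitions using (Decidable; Symmetric; Irreflexive)
open import Relation.Binary.PropositionalEquality using (_≡_; _≢_; sym)
open import Relation.Nullary using (¬_)
open import Relation.Nullary.Decidable using (_×-dec_; _⊎-dec_; ¬?)

-- Order 0 is allowed, since the line graph of an edgeless graph has no
-- vertices.
record Graph : Set₁ where
  field
    order      : ℕ
    Adj        : Rel (Fin order) 0ℓ
    adj?       : Decidable Adj
    adj-sym    : Symmetric Adj
    adj-irrefl : Irreflexive _≡_ Adj

  Vertex : Set
  Vertex = Fin order

open Graph public

HasEdge : Graph → Set
HasEdge G = ∃₂ λ u v → Adj G u v

degree : (G : Graph) → Vertex G → ℕ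
degree G v = length (filter (adj? G v) (allFin (order G)))

-- Every degree is smaller than the order, so the default value order G
-- of the minimum only matters for the graph without vertices.
minDegree : Graph → ℕ
minDegree G = min (order G) (map (degree G) (allFin (order G)))

-- Each edge is listed exactly once, as a pair (u , v) with u < v.
edges : (G : Graph) → List (Vertex G × Vertex G)
edges G = filter (λ (u , v) → (u <? v) ×-dec adj? G u v)
                 (cartesianProduct (allFin (order G)) (allFin (order G)))

averageDegree : (G : Graph) .{{_ : NonZero (order G)}} → ℚ
averageDegree G = + (2 ℕ.* length (edges G)) / order G

ShareEndpoint : ∀ {n} → Rel (Fin n × Fin n) 0ℓ
ShareEndpoint (u , v) (x , y) = (u ≡ x ⊎ v ≡ y) ⊎ (u ≡ y ⊎ v ≡ x)

-- The vertices of L(G) are the positions in the list of edges of G.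
lineGraph : Graph → Graph
lineGraph G = record
  { order      = length (edges G)
  ; Adj        = λ a b → a ≢ b × ShareEndpoint (edge a) (edge b)
  ; adj?       = λ a b → ¬? (a ≟ b) ×-dec share? (edge a) (edge b)
  ; adj-sym    = λ {a} {b} (a≢b , s) →
                   (λ b≡a → a≢b (sym b≡a)) , share-sym (edge a) (edge b) s
  ; adj-irrefl = λ a≡b (a≢b , _) → a≢b a≡b
  }
  where
  edge : Fin (length (edges G)) → Vertex G × Vertex G
  edge = lookup (edges G)

  share? : Decidable (ShareEndpoint {order G})
  share? (u , v) (x , y) = ((u ≟ x) ⊎-dec (v ≟ y)) ⊎-dec ((u ≟ y) ⊎-dec (v ≟ x))

  share-sym : ∀ e f → ShareEndpoint {order G} e f → ShareEndpoint f e
  share-sym _ _ (inj₁ (inj₁ p)) = inj₁ (inj₁ (sym p))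
  share-sym _ _ (inj₁ (inj₂ p)) = inj₁ (inj₂ (sym p))
  share-sym _ _ (inj₂ (inj₁ p)) = inj₂ (inj₂ (sym p))
  share-sym _ _ (inj₂ (inj₂ p)) = inj₂ (inj₁ (sym p))

-- Any two vertices satisfying P are joined by a walk whose vertices all
-- satisfy P. This holds trivially if no vertex satisfies P.
InducesConnected : (G : Graph) → (Vertex G → Set) → Set
InducesConnected G P =
  ∀ s t → P s → P t → Star (λ a b → P a × P b × Adj G a b) s t

Connected : Graph → Set
Connected G = ∀ s t → Star (Adj G) s t

-- A cycle is a sequence of at least three distinct vertices
-- v ∷ vs in which consecutive vertices, and the last and the first
-- one, are adjacent.
Acyclic : Graph → Set
Acyclic G = ∀ v vs → 2 ℕ.≤ length vs → Unique (v ∷ vs) →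
            ¬ Linked (Adj G) (v ∷ vs ∷ʳ v)

record IsTree (T : Graph) : Set where
  field
    nonempty  : NonZero (order T)
    connected : Connected T
    acyclic   : Acyclic T

-- The vertices can be listed so that exactly the consecutive ones are
-- adjacent; π sends a vertex to its position.
IsPath : Graph → Set
IsPath T = Σ[ π ∈ Permutation′ (order T) ] (∀ s t →
  Adj T s t ⇔ (toℕ (π ⟨$⟩ʳ t) ≡ suc (toℕ (π ⟨$⟩ʳ s)) ⊎
               toℕ (π ⟨$⟩ʳ s) ≡ suc (toℕ (π ⟨$⟩ʳ t))))

record TreeDecomposition (H : Graph) : Set₁ where
  field
    tree          : Graph
    isTree        : IsTree tree
    bag           : Vertex tree → Subset (order H)
    coversVertex  : ∀ v → ∃[ t ] v ∈ bag t
    bagsConnected : ∀ v → InducesConnected tree (λ t → v ∈ bag t)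
    coversEdge    : ∀ u v → Adj H u v → ∃[ t ] (u ∈ bag t × v ∈ bag t)

  width : ℤ
  width = + max 0 (map (λ t → ∣ bag t ∣) (allFin (order tree))) ℤ.- ℤ.1ℤ

open TreeDecomposition public using (tree; width)

-- tw and pw are given as relations "H has treewidth k": over decompositions
-- of unbounded size, the minimum is not directly available as a computable
-- function. For H without vertices, all bags are empty and k = -1.
IsTreewidth : Graph → ℤ → Set₁
IsTreewidth H k =
    (Σ[ D ∈ TreeDecomposition H ] width D ≡ k)
  × (∀ (D : TreeDecomposition H) → k ℤ.≤ width D)

IsPathwidth : Graph → ℤ → Set₁
IsPathwidth H k =
    (Σ[ D ∈ TreeDecomposition H ] (IsPath (tree D) × width D ≡ k))
  × (∀ (D : TreeDecomposition H) → IsPath (tree D) → k ℤ.≤ width D)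

-- w(L(G)) ≥ c · w(G) · d, for w = tw or w = pw. The widths w(G), w(L(G))
-- are unique, and quantifying over them universally makes the negation of
-- this statement non-vacuous: it refutes the inequality between the actual
-- values and cannot hold by absence of a value.
LineGraphBound : (IsWidth : Graph → ℤ → Set₁) → ℚ → Graph → ℚ → Set₁
LineGraphBound IsWidth c G d =
  ∀ w wL → IsWidth G w → IsWidth (lineGraph G) wL →
  wL / 1 ℚ.≥ c ℚ.* (w / 1) ℚ.* d

{-# OPTIONS --safe #-}
module Submission where

-- Let K = m² + 1, and let G have the vertices 0, …, K² - 1, with x and y
-- adjacent if 0 < |x - y| ≤ m or |x - y| = K. Write x = K i + j. A cross,
-- the union of a row (fixed i) and a column (fixed j), is connected, any
-- two crosses meet, and fewer than K vertices cannot hit every cross. By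
-- the Helly property of subtrees, some bag of every tree decomposition
-- hits all crosses, so tw(G) ≥ K - 1 = m². Every degree is at least m,
-- hence so are δ(G) and d(G), and the products tw(G) δ(G) and tw(G) d(G)
-- are at least m³. On the other hand, the edges xy with x ≤ t ≤ y, for
-- t = 0, …, K² - 1, are the bags of a path decomposition of L(G), and only
-- O(m²) edges straddle t: at most (m + 1)² short and K + 1 long ones.

open import Defs
open import Level using (0ℓ)
import Algebra.Properties.CommutativeMonoid.Sum as Sum′
open import Data.Bool.Base using (if_then_else_; true; false)
open import Data.Nat.Base as ℕ
  using (ℕ; zero; suc; NonZero; s≤s; z≤n; _≤_; _+_; _*_; _∸_; ∣_-_∣)
import Data.Nat.Properties as ℕ
open import Data.Nat.GeneralisedArithmetic using (iterate)
open import Data.Nat.Tactic.RingSolver using (solve-∀)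
open import Data.Integer.Base as ℤ using (ℤ; +_; -≤+; +≤+)
import Data.Integer.Properties as ℤ
open import Data.Rational.Base as ℚ using (ℚ; 0ℚ; 1ℚ; _/_; _<_; mkℚ; toℚᵘ)
import Data.Rational.Properties as ℚ
open import Data.Rational.Unnormalised.Base as ℚᵘ using (mkℚᵘ)
import Data.Rational.Unnormalised.Properties as ℚᵘ
open import Data.Fin.Base as Fin
  using (Fin; zero; suc; toℕ; fromℕ<; quotient; remainder; combine; join; splitAt)
open import Data.Fin.Properties
  using (_≟_; _≤?_; _<?_; <-cmp; any?; ¬∀⟶∃¬; pigeonhole; injective⇒≤; suc-injective;
         toℕ-injective; toℕ-fromℕ<; toℕ<n; fromℕ<-injective; toℕ-combine; remQuot-combine;
         combine-remQuot; combine-injective; splitAt-join; nonZeroIndex)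
import Data.Fin.Permutation as Perm
open import Data.Fin.Subset using (Subset; inside; outside; ∣_∣; _∈_; _∉_)
open import Data.Fin.Subset.Properties using (_∈?_)
open import Data.Vec.Base as Vec using (_∷_; []; here; there)
open import Data.Vec.Properties using (lookup∘tabulate; lookup⇒[]=; []=⇒lookup)
open import Data.List.Base
  using (List; []; _∷_; _∷ʳ_; _++_; map; filter; allFin; length; lookup; cartesianProduct; tabulate)
open import Data.List.Extrema.Nat using (max; max≤v⁺; xs≤max; v≤min⁺; min≤xs)
open import Data.List.Properties using (filter-++; length-++)
import Data.List.Membership.Propositional as List
import Data.List.Membership.DecPropositional as DecMembership
open import Data.List.Membership.Propositional.Properties
  using (∈-allFin; ∈-map⁺; ∈-filter⁺; ∈-filter⁻; ∈-lookup)
import Data.List.Membership.Setoid.Properties as SetoidMembership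
open import Data.List.Relation.Unary.Any as Any using (here; there)
open import Data.List.Relation.Unary.All as All using (All; []; _∷_)
import Data.List.Relation.Unary.All.Properties as All
open import Data.List.Relation.Unary.AllPairs.Core using ([]; _∷_)
open import Data.List.Relation.Unary.Linked as Linked using (Linked; [-]; _∷_)
open import Data.List.Relation.Unary.Unique.Propositional using (Unique)
import Data.List.Relation.Unary.Unique.Propositional.Properties as Unique
open import Data.Product.Base using (Σ-syntax; ∃-syntax; _×_; _,_; proj₁; proj₂)
open import Data.Sum.Base as Sum using (_⊎_; inj₁; inj₂)
open import Data.Sum.Properties using (inj₁-injective; inj₂-injective)
open import Data.Unit.Base using (⊤)
open import Function.Base using (_∘_; flip; id)
open import Function.Bundles using (mk⇔)
open import Relation.Binary.Core using (Rel; _⇒_)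
open import Relation.Binary.Definitions
  using (DecidableEquality; Transitive; Tri; tri<; tri≈; tri>)
open import Relation.Binary.Construct.Closure.ReflexiveTransitive as Star
  using (Star; ε; _◅_; _◅◅_)
open import Relation.Binary.PropositionalEquality
open import Relation.Nullary using (¬_; Dec; yes; no; does; contradiction)
open import Relation.Nullary.Decidable using (_×-dec_; _⊎-dec_; ¬?; dec-true; dec-false)
open import Relation.Unary using (Pred; Decidable)

private
  variable
    n k : ℕ

-- The Helly property of subtrees

Avoiding : {A : Set} → Rel A 0ℓ → A → Rel A 0ℓ
Avoiding R s a b = a ≢ s × b ≢ s × R a b

-- A walk from `a` to `z`; the list holds the vertices after `a`, so that `a ∷ xs` is the whole
-- vertex sequence.
data Chain {A : Set} (R : Rel A 0ℓ) (z : A) : A → List A → Set where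
  end : Chain R z z []
  _∷_ : ∀ {a b xs} → R a b → Chain R z b xs → Chain R z a (b ∷ xs)

module _ {A : Set} {R : Rel A 0ℓ} where

  suffix : ∀ {a b z xs} → Chain R z b xs → Unique (b ∷ xs) → a List.∈ b ∷ xs →
           ∃[ ys ] (Chain R z a ys × Unique (a ∷ ys))
  suffix c       u       (here refl) = _ , c , u
  suffix (_ ∷ c) (_ ∷ u) (there a∈)  = suffix c u a∈

  chain⇒linked : ∀ {S : Rel A 0ℓ} {a y z xs} → R ⇒ S → Chain R y a xs →
                 S y z → Linked S (a ∷ xs ∷ʳ z)
  chain⇒linked f end     s = s ∷ [-]
  chain⇒linked f (r ∷ c) s = f r ∷ chain⇒linked f c s

  module _ (_≟ᴬ_ : DecidableEquality A) where

    open DecMembership _≟ᴬ_ using () renaming (_∈?_ to _∈ᴸ?_)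

    -- Loop erasure: if `a` already lies on the simple path obtained from the rest of the walk, that
    -- path is cut back to `a`.
    simplePath : ∀ {a z} → Star R a z → ∃[ xs ] (Chain R z a xs × Unique (a ∷ xs))
    simplePath ε = [] , end , [] ∷ []
    simplePath {a} (_◅_ {j = b} r w) with simplePath w
    ... | xs , c , u with a ∈ᴸ? (b ∷ xs)
    ...   | yes a∈ = suffix c u a∈
    ...   | no  a∉ = b ∷ xs , r ∷ c , All.¬Any⇒All¬ _ a∉ ∷ u

    -- The walk is searched from its end: the visit to `s` found first in this order is the last
    -- one, and what follows it avoids `s`.
    lastExit : ∀ {s u} → Star R s u → u ≢ s →
               ∃[ t ] (R s t × Star (Avoiding R s) t u)
    lastExit {s} {u} w u≢s with go w
      where
      go : ∀ {x} → Star R x u →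
           (x ≢ s × Star (Avoiding R s) x u) ⊎ ∃[ t ] (R s t × Star (Avoiding R s) t u)
      go ε = inj₁ (u≢s , ε)
      go {x} (r ◅ w) with go w
      ... | inj₂ found = inj₂ found
      ... | inj₁ (y≢s , w′) with x ≟ᴬ s
      ...   | yes refl = inj₂ (_ , r , w′)
      ...   | no  x≢s  = inj₁ (x≢s , (x≢s , y≢s , r) ◅ w′)
    ... | inj₁ (s≢s , _) = contradiction refl s≢s
    ... | inj₂ found     = found

  chain-avoids : ∀ {s a z xs} → Chain (Avoiding R s) z a xs → s ≢ a → All (s ≢_) (a ∷ xs)
  chain-avoids end               s≢a = s≢a ∷ []
  chain-avoids ((_ , b≢s , _) ∷ c) s≢a = s≢a ∷ chain-avoids c (b≢s ∘ sym)

  avoids : ∀ {s a z} → Star (Avoiding R s) a z → a ≢ s → z ≢ s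
  avoids ε                   a≢s = a≢s
  avoids ((_ , b≢s , _) ◅ w) _   = avoids w b≢s

module _ (T : Graph) where

  adj⇒≢ : ∀ {s t} → Adj T s t → s ≢ t
  adj⇒≢ st s≡t = adj-irrefl T s≡t st

  -- If t ≢ s, then Beyond s t u says that u is in the component of T - s
  -- containing t.
  Beyond : Vertex T → Vertex T → Vertex T → Set
  Beyond s = Star (Avoiding (Adj T) s)

  beyond-sym : ∀ {s t u} → Beyond s t u → Beyond s u t
  beyond-sym = Star.reverse (λ (a≢s , b≢s , r) → b≢s , a≢s , adj-sym T r)

module _ {T : Graph} (isTree : IsTree T) where

  open IsTree isTree

  -- Two distinct neighbours of `s` joined by a simple path in T - s would close up to a cycle
  -- through `s`.
  neighbour-unique : ∀ {s t t′} → Adj T s t → Adj T s t′ → Beyond T s t t′ → t ≡ t′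
  neighbour-unique st st′ w with simplePath _≟_ w
  ... | []     , end , _ = refl
  ... | c ∷ xs , ch  , u = contradiction
    (st ∷ chain⇒linked (proj₂ ∘ proj₂) ch (adj-sym T st′))
    (acyclic _ (_ ∷ c ∷ xs) (s≤s (s≤s z≤n)) (chain-avoids ch (adj⇒≢ T st) ∷ u))

  -- A walk from `r` in T - t never enters `s`: otherwise `r` and `s`, both neighbours of `t`, would
  -- be joined in T - t and hence equal. For this reason `go` keeps the part of the walk already
  -- traversed.
  beyond-shrinks : ∀ {s t r u} → Adj T s t → Adj T t r → r ≢ s →
                   Beyond T t r u → Beyond T s t u
  beyond-shrinks {s} {t} {r} st tr r≢s w =
    (adj⇒≢ T st ∘ sym , r≢s , tr) ◅ go ε r≢s w
    where
    go : ∀ {x u} → Beyond T t r x → x ≢ s → Beyond T t x u → Beyond T s x u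
    go rx x≢s ε = ε
    go rx x≢s (step@(_ , _ , xy) ◅ yu) = (x≢s , y≢s , xy) ◅ go ry y≢s yu
      where
      ry = rx ◅◅ (step ◅ ε)
      y≢s = λ { refl → r≢s (neighbour-unique tr (adj-sym T st) ry) }

  -- A walk from `s` to `u` in T - t leaves `s` for the last time towards some `s′ ≢ t`. Then `t`
  -- and `s′` are distinct neighbours of `s` joined through `u` in T - s.
  beyond-disjoint : ∀ {s t u} → Adj T s t → Beyond T s t u → ¬ Beyond T t s u
  beyond-disjoint st tu su with lastExit _≟_ su (avoids tu (adj⇒≢ T st ∘ sym))
  ... | s′ , (_ , s′≢t , ss′) , w = s′≢t (sym (neighbour-unique st ss′
    (tu ◅◅ beyond-sym T (Star.map (λ (a , b , _ , _ , r) → a , b , r) w))))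

  -- A choice of neighbours that never backtracks walks along T forever
  -- without repeating a vertex.
  choice-backtracks : (f : Vertex T → Vertex T) → (∀ s → Adj T s (f s)) →
                      ¬ (∀ s → f (f s) ≢ s)
  choice-backtracks f adj nb =
    let i , j , i<j , eq = pigeonhole (ℕ.n<1+n (order T)) (iterate f root ∘ toℕ)
    in distinct root i<j eq
    where
    root : Vertex T
    root = fromℕ< (ℕ.>-nonZero⁻¹ (order T) {{nonempty}})

    -- All later iterates stay on the far side of the edge from `s` to `f s`, so the walk never
    -- returns to `s`.
    beyond : ∀ d s → Beyond T s (f s) (iterate f (f s) d)
    beyond zero    s = ε
    beyond (suc d) s = beyond-shrinks (adj s) (adj (f s)) (nb s) (beyond d (f s))

    distinct : ∀ s {i j} → i ℕ.< j → iterate f s i ≢ iterate f s j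
    distinct s {zero}  {suc j} _         = avoids (beyond j s) (adj⇒≢ T (adj s) ∘ sym) ∘ sym
    distinct s {suc i} {suc j} (s≤s i<j) = distinct (f s) i<j

  -- From each s, step to the neighbour towards a set that misses s. Stepping
  -- back along the same edge would mean that this edge separates two of the
  -- sets.
  helly : {I : Set} (P : I → Vertex T → Set) →
          (∀ i → InducesConnected T (P i)) →
          (∀ i j → ∃[ t ] (P i t × P j t)) →
          ¬ (∀ s → ∃[ i ] ¬ P i s)
  helly {I} P conn meet miss = choice-backtracks (proj₁ ∘ towards) (proj₁ ∘ proj₂ ∘ towards)
    λ s → forward (proj₂ (towards s)) (proj₂ (towards _))
    where
    Towards : Vertex T → Vertex T → Set
    Towards s t = Adj T s t × ∃[ i ] (∀ {u} → P i u → Beyond T s t u)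

    towards : ∀ s → ∃[ t ] Towards s t
    towards s with miss s
    -- Taking both indices equal in `meet` gives a point of the missed set. The walk towards it
    -- fixes the direction `t`, and connectedness places the whole set beyond `t`.
    ... | i , ¬Pis with meet i i
    ...   | u , Piu , _ with lastExit _≟_ (connected s u) (λ { refl → ¬Pis Piu })
    ...     | t , st , tu = t , st , i , λ Piv → tu ◅◅ Star.map
                (λ (Pa , Pb , r) → (λ { refl → ¬Pis Pa }) , (λ { refl → ¬Pis Pb }) , r)
                (conn i _ _ Piu Piv)

    forward : ∀ {s t r} → Towards s t → Towards t r → r ≢ s
    forward (st , i , Pi) (_ , j , Pj) refl =
      let u , Piu , Pju = meet i j in beyond-disjoint st (Pi Piu) (Pj Pju)

-- Subsets of finite sets

enumerate : (p : Subset n) → Fin ∣ p ∣ → Fin n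
enumerate (inside  ∷ p) zero    = zero
enumerate (inside  ∷ p) (suc i) = suc (enumerate p i)
enumerate (outside ∷ p) i       = suc (enumerate p i)

enumerate-∈ : (p : Subset n) (i : Fin ∣ p ∣) → enumerate p i ∈ p
enumerate-∈ (inside  ∷ p) zero    = here
enumerate-∈ (inside  ∷ p) (suc i) = there (enumerate-∈ p i)
enumerate-∈ (outside ∷ p) i       = there (enumerate-∈ p i)

enumerate-injective : (p : Subset n) {i j : Fin ∣ p ∣} → enumerate p i ≡ enumerate p j → i ≡ j
enumerate-injective (inside  ∷ p) {zero}  {zero}  _  = refl
enumerate-injective (inside  ∷ p) {suc i} {suc j} eq = cong suc (enumerate-injective p (suc-injective eq))
enumerate-injective (outside ∷ p) eq = enumerate-injective p (suc-injective eq)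

rank : {p : Subset n} {x : Fin n} → x ∈ p → Fin ∣ p ∣
rank {p = inside  ∷ p} here        = zero
rank {p = inside  ∷ p} (there x∈p) = suc (rank x∈p)
rank {p = outside ∷ p} (there x∈p) = rank x∈p

enumerate-rank : {p : Subset n} {x : Fin n} (x∈p : x ∈ p) → enumerate p (rank x∈p) ≡ x
enumerate-rank {p = inside  ∷ p} here        = refl
enumerate-rank {p = inside  ∷ p} (there x∈p) = cong suc (enumerate-rank x∈p)
enumerate-rank {p = outside ∷ p} (there x∈p) = cong suc (enumerate-rank x∈p)

-- `f` may use the membership proof: the codes of edges below are bounded only for edges in the bag.
injectiveOn⇒∣p∣≤ : (p : Subset n) (f : ∀ {x} → x ∈ p → Fin k) →
                   (∀ {x y} (x∈p : x ∈ p) (y∈p : y ∈ p) → f x∈p ≡ f y∈p → x ≡ y) → ∣ p ∣ ≤ k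
injectiveOn⇒∣p∣≤ p f inj = injective⇒≤ {f = λ i → f (enumerate-∈ p i)} λ {i} {j} eq →
  enumerate-injective p (inj (enumerate-∈ p i) (enumerate-∈ p j) eq)

injectiveInto⇒≤∣p∣ : (p : Subset n) (f : Fin k → Fin n) → (∀ {i j} → f i ≡ f j → i ≡ j) →
                     (∀ i → f i ∈ p) → k ≤ ∣ p ∣
injectiveInto⇒≤∣p∣ p f inj f∈p = injective⇒≤ {f = λ i → rank (f∈p i)} λ {i} {j} eq →
  inj (trans (sym (enumerate-rank (f∈p i))) (trans (cong (enumerate p) eq) (enumerate-rank (f∈p j))))

module _ {ℓ} {P : Pred (Fin n) ℓ} (P? : Decidable P) where

  comprehension : Subset n
  comprehension = Vec.tabulate (does ∘ P?)

  ∈-comprehension⁺ : ∀ {x} → P x → x ∈ comprehension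
  ∈-comprehension⁺ {x} px =
    lookup⇒[]= x _ (trans (lookup∘tabulate (does ∘ P?) x) (dec-true (P? x) px))

  ∈-comprehension⁻ : ∀ {x} → x ∈ comprehension → P x
  ∈-comprehension⁻ {x} x∈ with P? x | trans (sym (lookup∘tabulate (does ∘ P?) x)) ([]=⇒lookup x∈)
  ... | yes px | _  = px
  ... | no  _  | ()

-- Path decompositions

module _ {A : Set} {S _≺_ : Rel A 0ℓ} (≺-trans : Transitive _≺_)
         (S⇒≺ : ∀ {a b} → S a b → a ≺ b) (S-injective : ∀ {a b c} → S a c → S b c → a ≡ b) where

  -- A walk along steps of S and reversed steps of S that does not
  -- backtrack never changes direction.
  linked⇒≺ : ∀ {a b z} xs → S a b → Linked (λ x y → S x y ⊎ S y x) (b ∷ xs ∷ʳ z) →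
             Unique (a ∷ b ∷ xs) → All (z ≢_) (a ∷ b ∷ xs) → a ≺ z
  linked⇒≺ []       ab (inj₁ bz ∷ [-]) _ _ = ≺-trans (S⇒≺ ab) (S⇒≺ bz)
  linked⇒≺ []       ab (inj₂ zb ∷ [-]) _ (z≢a ∷ _) = contradiction (S-injective zb ab) z≢a
  linked⇒≺ (c ∷ xs) ab (inj₁ bc ∷ l) (_ ∷ u) (_ ∷ z∉) = ≺-trans (S⇒≺ ab) (linked⇒≺ xs bc l u z∉)
  linked⇒≺ (c ∷ xs) ab (inj₂ cb ∷ l) ((_ ∷ a≢c ∷ _) ∷ _) _ =
    contradiction (S-injective ab cb) a≢c

  -- The rest of the cycle is a walk from `b` to `v` that does not meet `v` earlier, so `linked⇒≺`
  -- applies. For a strict order the result is absurd.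
  cycle⇒≺ : ∀ {v b} c xs → S v b → Linked (λ x y → S x y ⊎ S y x) (b ∷ c ∷ xs ∷ʳ v) →
            Unique (v ∷ b ∷ c ∷ xs) → v ≺ v
  cycle⇒≺ c xs vb (inj₁ bc ∷ l) (v∉ ∷ u) = ≺-trans (S⇒≺ vb) (linked⇒≺ xs bc l u v∉)
  cycle⇒≺ c xs vb (inj₂ cb ∷ l) ((_ ∷ v≢c ∷ _) ∷ _) = contradiction (S-injective vb cb) v≢c

pathGraph : ℕ → Graph
pathGraph n = record
  { order      = n
  ; Adj        = λ s t → toℕ t ≡ suc (toℕ s) ⊎ toℕ s ≡ suc (toℕ t)
  ; adj?       = λ s t → (toℕ t ℕ.≟ suc (toℕ s)) ⊎-dec (toℕ s ℕ.≟ suc (toℕ t))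
  ; adj-sym    = Sum.swap
  ; adj-irrefl = λ { refl → Sum.[ ℕ.1+n≢n ∘ sym , ℕ.1+n≢n ∘ sym ] }
  }

pathGraph-isPath : ∀ n → IsPath (pathGraph n)
pathGraph-isPath n = Perm.id , λ _ _ → mk⇔ id id

module _ {n : ℕ} {P : Fin n → Set}
         (convex : ∀ {a b c} → toℕ a ≤ toℕ b → toℕ b ≤ toℕ c → P a → P c → P b) where

  private
    Within : Rel (Fin n) 0ℓ
    Within a b = P a × P b × Adj (pathGraph n) a b

    ascend : ∀ d s t → toℕ t ≡ d + toℕ s → P s → P t → Star Within s t
    ascend zero    s t eq Ps Pt with refl ← toℕ-injective eq = ε
    ascend (suc d) s t eq Ps Pt = (Ps , Pb , inj₁ b≡1+s) ◅ ascend d b t eq′ Pb Pt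
      where
      1+s≤t : suc (toℕ s) ≤ toℕ t
      1+s≤t = subst (suc (toℕ s) ≤_) (sym eq) (s≤s (ℕ.m≤n+m _ d))
      b : Fin n
      b = fromℕ< (ℕ.≤-<-trans 1+s≤t (toℕ<n t))
      b≡1+s : toℕ b ≡ suc (toℕ s)
      b≡1+s = toℕ-fromℕ< (ℕ.≤-<-trans 1+s≤t (toℕ<n t))
      Pb : P b
      Pb = convex (subst (toℕ s ≤_) (sym b≡1+s) (ℕ.n≤1+n _))
                  (subst (_≤ toℕ t) (sym b≡1+s) 1+s≤t) Ps Pt
      eq′ : toℕ t ≡ d + toℕ b
      eq′ = trans eq (trans (sym (ℕ.+-suc d _)) (cong (λ m → d + m) (sym b≡1+s)))

  convex⇒connected : InducesConnected (pathGraph n) P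
  convex⇒connected s t Ps Pt with ℕ.≤-total (toℕ s) (toℕ t)
  ... | inj₁ s≤t = ascend _ s t (sym (ℕ.m∸n+n≡m s≤t)) Ps Pt
  ... | inj₂ t≤s = Star.reverse (λ (Pa , Pb , ab) → Pb , Pa , adj-sym (pathGraph n) ab)
                     (ascend _ t s (sym (ℕ.m∸n+n≡m t≤s)) Pt Ps)

-- The direction of the first step decides whether `cycle⇒≺` is used with the successor relation and
-- `<` or with its converse and `>`.
pathGraph-acyclic : ∀ n → Acyclic (pathGraph n)
pathGraph-acyclic n v (b ∷ [])     (s≤s ())
pathGraph-acyclic n v (b ∷ c ∷ xs) _ u (inj₁ up ∷ l) = ℕ.<-irrefl {toℕ v} refl
  (cycle⇒≺ {S = λ s t → toℕ t ≡ suc (toℕ s)} {_≺_ = Fin._<_} ℕ.<-trans (ℕ.≤-reflexive ∘ sym)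
    (λ p q → toℕ-injective (ℕ.suc-injective (trans (sym p) q))) c xs up l u)
pathGraph-acyclic n v (b ∷ c ∷ xs) _ u (inj₂ down ∷ l) = ℕ.<-irrefl {toℕ v} refl
  (cycle⇒≺ {S = λ s t → toℕ s ≡ suc (toℕ t)} {_≺_ = Fin._>_} (flip ℕ.<-trans) (ℕ.≤-reflexive ∘ sym)
    (λ p q → toℕ-injective (trans p (sym q))) c xs down (Linked.map Sum.swap l) u)

pathGraph-isTree : ∀ n .{{_ : NonZero n}} → IsTree (pathGraph n)
pathGraph-isTree n@(suc _) = record
  { nonempty  = _
  ; connected = λ s t → Star.map (proj₂ ∘ proj₂) (convex⇒connected {P = λ _ → ⊤} _ s t _ _)
  ; acyclic   = pathGraph-acyclic n
  }

module _ (H : Graph) (N : ℕ) .{{_ : NonZero N}} (lo hi : Vertex H → Fin N)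
         (lo≤hi : ∀ v → lo v Fin.≤ hi v)
         (intersect : ∀ u v → Adj H u v → lo u Fin.≤ hi v) where

  private
    between? : ∀ (t : Fin N) → Decidable (λ v → lo v Fin.≤ t × t Fin.≤ hi v)
    between? t v = (lo v ≤? t) ×-dec (t ≤? hi v)

  -- Each vertex `v` is represented by the interval from `lo v` to `hi v`; the bag at `t` collects
  -- the intervals through `t`.
  intervalDecomposition : TreeDecomposition H
  intervalDecomposition = record
    { tree          = pathGraph N
    ; isTree        = pathGraph-isTree N
    ; bag           = bag
    ; coversVertex  = λ v → lo v , ∈-bag⁺ (ℕ.≤-refl , lo≤hi v)
    ; bagsConnected = λ v → convex⇒connected λ a≤b b≤c a∈ c∈ →
        ∈-bag⁺ (ℕ.≤-trans (proj₁ (∈-bag⁻ a∈)) a≤b , ℕ.≤-trans b≤c (proj₂ (∈-bag⁻ c∈)))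
    ; coversEdge    = coversEdge
    }
    where
    bag : Fin N → Subset (order H)
    bag t = comprehension (between? t)
    ∈-bag⁺ : ∀ {t v} → lo v Fin.≤ t × t Fin.≤ hi v → v ∈ bag t
    ∈-bag⁺ {t} = ∈-comprehension⁺ (between? t)
    ∈-bag⁻ : ∀ {t v} → v ∈ bag t → lo v Fin.≤ t × t Fin.≤ hi v
    ∈-bag⁻ {t} = ∈-comprehension⁻ (between? t)
    coversEdge : ∀ u v → Adj H u v → ∃[ t ] (u ∈ bag t × v ∈ bag t)
    -- The larger of the two left ends lies in both intervals.
    coversEdge u v uv with ℕ.≤-total (toℕ (lo u)) (toℕ (lo v))
    ... | inj₁ u≤v = lo v , ∈-bag⁺ (u≤v , intersect v u (adj-sym H uv)) , ∈-bag⁺ (ℕ.≤-refl , lo≤hi v)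
    ... | inj₂ v≤u = lo u , ∈-bag⁺ (ℕ.≤-refl , lo≤hi u) , ∈-bag⁺ (v≤u , intersect u v uv)

  intervalDecomposition-bag⁻ : ∀ {t v} → v ∈ TreeDecomposition.bag intervalDecomposition t →
                               lo v Fin.≤ t × t Fin.≤ hi v
  intervalDecomposition-bag⁻ {t} = ∈-comprehension⁻ (between? t)

-- Widths

module _ {H : Graph} (D : TreeDecomposition H) where

  open TreeDecomposition D using (bag)

  maxBag : ℕ
  maxBag = max 0 (map (λ t → ∣ bag t ∣) (allFin (order (tree D))))

  ∣bag∣≤maxBag : ∀ t → ∣ bag t ∣ ≤ maxBag
  ∣bag∣≤maxBag t = All.lookup (xs≤max 0 _) (∈-map⁺ (λ t → ∣ bag t ∣) (∈-allFin t))

  ∣bag∣≤⇒width≤ : ∀ {k} → (∀ t → ∣ bag t ∣ ≤ suc k) → width D ℤ.≤ + k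
  ∣bag∣≤⇒width≤ {k} h = pred≤
    (max≤v⁺ {xs = map (λ t → ∣ bag t ∣) (allFin _)} z≤n (All.map⁺ (All.universal h _)))
    where
    pred≤ : ∀ {m} → m ≤ suc k → + m ℤ.- ℤ.1ℤ ℤ.≤ + k
    pred≤ {zero}  _         = -≤+
    pred≤ {suc m} (s≤s m≤k) = +≤+ m≤k

  ¬∣bag∣≤⇒≤width : ∀ {k} → ¬ (∀ t → ∣ bag t ∣ ≤ k) → + k ℤ.≤ width D
  ¬∣bag∣≤⇒≤width {k} h = ≤pred (ℕ.≰⇒> λ m≤k → h λ t → ℕ.≤-trans (∣bag∣≤maxBag t) m≤k)
    where
    ≤pred : ∀ {m} → k ℕ.< m → + k ℤ.≤ + m ℤ.- ℤ.1ℤ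
    ≤pred {suc m} (s≤s k≤m) = +≤+ k≤m

-- Constructively, a minimum over decompositions of unbounded size exists
-- only up to double negation; this suffices to refute an inequality.
¬¬-minimum : ∀ {a} {A : Set a} (f : A → ℕ) → A → ¬ ¬ (Σ[ x ∈ A ] (∀ y → f x ≤ f y))
¬¬-minimum {A = A} f x₀ none = go (f x₀) x₀ ℕ.≤-refl
  where
  -- Descent on the bound `n`: if no `y` had a smaller value, `x` would be a minimum.
  go : ∀ n x → ¬ (f x ≤ n)
  go n x fx≤n = none (x , λ y → ℕ.≮⇒≥ λ fy<fx → descend n y (ℕ.<-≤-trans fy<fx fx≤n))
    where
    descend : ∀ n y → ¬ (f y ℕ.< n)
    descend (suc n) y (s≤s fy≤n) = go n y fy≤n

-- A single bag with all vertices, from which the descent to a minimum starts.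
trivialDecomposition : ∀ H → TreeDecomposition H
trivialDecomposition H = intervalDecomposition H 1 (λ _ → zero) (λ _ → zero) (λ _ → z≤n) (λ _ _ _ → z≤n)

¬¬-treewidth : ∀ H → ¬ ¬ (Σ[ k ∈ ℤ ] IsTreewidth H k)
¬¬-treewidth H none = ¬¬-minimum maxBag (trivialDecomposition H) λ (D , min) →
  none (width D , (D , refl) , λ D′ → ℤ.+-monoˡ-≤ ℤ.-1ℤ (+≤+ (min D′)))

¬¬-pathwidth : ∀ H → ¬ ¬ (Σ[ k ∈ ℤ ] IsPathwidth H k)
¬¬-pathwidth H none = ¬¬-minimum {A = Σ[ D ∈ TreeDecomposition H ] IsPath (tree D)} (maxBag ∘ proj₁)
  (trivialDecomposition H , pathGraph-isPath 1) λ ((D , path) , min) →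
  none (width D , (D , path , refl) , λ D′ path′ → ℤ.+-monoˡ-≤ ℤ.-1ℤ (+≤+ (min (D′ , path′))))

-- Lower bounds on treewidth

module _ {G : Graph} {I : Set} (X : I → Vertex G → Set)
         (connected : ∀ i → InducesConnected G (X i))
         (meet : ∀ i j → ∃[ v ] (X i v × X j v)) where

  -- The nodes whose bags hit `X i` induce a subtree, and a bag containing a common vertex of `X i`
  -- and `X j` lies in both subtrees. This is the lower bound half of bramble duality, for brambles
  -- whose members pairwise intersect.
  pairwiseMeeting⇒hittingBag : (D : TreeDecomposition G) →
    ¬ (∀ t → ∃[ i ] (∀ v → X i v → v ∉ TreeDecomposition.bag D t))
  pairwiseMeeting⇒hittingBag D miss = helly isTree Hit hit-connected hit-meet λ t →
    let i , avoid = miss t in i , λ (v , Xv , v∈t) → avoid v Xv v∈t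
    where
    open TreeDecomposition D hiding (tree)

    Hit : I → Vertex (tree D) → Set
    Hit i t = ∃[ v ] (X i v × v ∈ bag t)

    hit-connected : ∀ i → InducesConnected (tree D) (Hit i)
    hit-connected i s t (x , Xx , x∈s) (y , Xy , y∈t) = go s x∈s Xx (connected i x y Xx Xy)
      where
      Within : Vertex (tree D) → Vertex (tree D) → Set
      Within a b = Hit i a × Hit i b × Adj (tree D) a b

      stay : ∀ {x s t} → X i x → x ∈ bag s → x ∈ bag t → Star Within s t
      stay Xx x∈s x∈t = Star.map (λ (x∈a , x∈b , ab) → (_ , Xx , x∈a) , (_ , Xx , x∈b) , ab)
                          (bagsConnected _ _ _ x∈s x∈t)

      -- Consecutive vertices of a walk in `X i` share a bag; between such bags the current vertex
      -- is carried along by `stay`.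
      go : ∀ {x} s → x ∈ bag s → X i x → Star (λ a b → X i a × X i b × Adj G a b) x y → Star Within s t
      go s x∈s Xx ε = stay Xx x∈s y∈t
      go s x∈s Xx ((_ , Xz , xz) ◅ w) =
        let r , x∈r , z∈r = coversEdge _ _ xz in stay Xx x∈s x∈r ◅◅ go r z∈r Xz w

    hit-meet : ∀ i j → ∃[ t ] (Hit i t × Hit j t)
    hit-meet i j =
      let v , Xi , Xj = meet i j
          t , v∈t     = coversVertex v
      in t , (v , Xi , v∈t) , (v , Xj , v∈t)

-- Otherwise choosing a preimage in `p` for every value would inject `Fin k` into `p`.
missedValue : (p : Subset n) (f : Fin n → Fin k) → ∣ p ∣ ℕ.< k → ∃[ i ] (∀ {x} → x ∈ p → f x ≢ i)
missedValue {k = k} p f ∣p∣<k =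
  let i , missed = ¬∀⟶∃¬ k (λ i → ∃[ x ] (x ∈ p × f x ≡ i))
                     (λ i → any? λ x → (x ∈? p) ×-dec (f x ≟ i)) notSurjective
  in i , λ x∈p fx≡i → missed (_ , x∈p , fx≡i)
  where
  notSurjective : ¬ (∀ i → ∃[ x ] (x ∈ p × f x ≡ i))
  notSurjective g = ℕ.<⇒≱ ∣p∣<k (injectiveInto⇒≤∣p∣ p (proj₁ ∘ g)
    (λ {i} {j} eq → trans (sym (proj₂ (proj₂ (g i)))) (trans (cong f eq) (proj₂ (proj₂ (g j)))))
    (proj₁ ∘ proj₂ ∘ g))

-- Edges and degrees

lookup-injective : ∀ {A : Set} {xs : List A} → Unique xs → ∀ {i j} → lookup xs i ≡ lookup xs j → i ≡ j
lookup-injective (_   ∷ u) {zero}  {zero}  _  = refl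
lookup-injective (x∉  ∷ u) {zero}  {suc j} eq = contradiction eq (All.lookup x∉ (∈-lookup j))
lookup-injective (x∉  ∷ u) {suc i} {zero}  eq = contradiction (sym eq) (All.lookup x∉ (∈-lookup i))
lookup-injective (_   ∷ u) {suc i} {suc j} eq = cong suc (lookup-injective u eq)

module _ (G : Graph) where

  source target : Fin (length (edges G)) → Vertex G
  source e = proj₁ (lookup (edges G) e)
  target e = proj₂ (lookup (edges G) e)

  isEdge? : Decidable (λ ((u , v) : Vertex G × Vertex G) → u Fin.< v × Adj G u v)
  isEdge? (u , v) = (u <? v) ×-dec adj? G u v

  edge-valid : ∀ e → source e Fin.< target e × Adj G (source e) (target e)
  edge-valid e = proj₂ (∈-filter⁻ isEdge?
    {xs = cartesianProduct (allFin (order G)) (allFin (order G))} (∈-lookup e))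

  edge-injective : ∀ {e f} → source e ≡ source f → target e ≡ target f → e ≡ f
  edge-injective p q = lookup-injective
    (Unique.filter⁺ isEdge? (Unique.cartesianProduct⁺ (Unique.allFin⁺ _) (Unique.allFin⁺ _)))
    (cong₂ _,_ p q)

  source≤target : ∀ e → source e Fin.≤ target e
  source≤target e = ℕ.<⇒≤ (proj₁ (edge-valid e))

  -- A shared endpoint lies in the intervals spanned by both edges; the four cases tell which ends
  -- coincide.
  adjacent⇒source≤target : ∀ e f → Adj (lineGraph G) e f → source e Fin.≤ target f
  adjacent⇒source≤target e f (_ , inj₁ (inj₁ p)) = subst (Fin._≤ target f) (sym p) (source≤target f)
  adjacent⇒source≤target e f (_ , inj₁ (inj₂ p)) = subst (source e Fin.≤_) p (source≤target e)
  adjacent⇒source≤target e f (_ , inj₂ (inj₁ p)) = ℕ.≤-reflexive (cong toℕ p)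
  adjacent⇒source≤target e f (_ , inj₂ (inj₂ p)) =
    ℕ.≤-trans (source≤target e) (subst (Fin._≤ target f) (sym p) (source≤target f))

  module _ .{{_ : NonZero (order G)}} where

    -- Every edge of `G` becomes the interval between its ends, so the bag at `t` consists of the
    -- edges straddling `t`.
    lineGraphDecomposition : TreeDecomposition (lineGraph G)
    lineGraphDecomposition = intervalDecomposition (lineGraph G) (order G) source target
                               source≤target adjacent⇒source≤target

    lineGraphDecomposition-bag⁻ : ∀ {t e} → e ∈ TreeDecomposition.bag lineGraphDecomposition t →
                                  source e Fin.≤ t × t Fin.≤ target e
    lineGraphDecomposition-bag⁻ {t} = intervalDecomposition-bag⁻ (lineGraph G) (order G) source target
                                        source≤target adjacent⇒source≤target {t}

  injection⇒≤degree : ∀ v (f : Fin k → Vertex G) → (∀ {i j} → f i ≡ f j → i ≡ j) →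
                      (∀ i → Adj G v (f i)) → k ≤ degree G v
  injection⇒≤degree v f inj vf = injective⇒≤ {f = Any.index ∘ f∈} λ {i} {j} eq →
    inj (SetoidMembership.index-injective (setoid _) (f∈ i) (f∈ j) eq)
    where
    f∈ : ∀ i → f i List.∈ filter (adj? G v) (allFin (order G))
    f∈ i = ∈-filter⁺ (adj? G v) (∈-allFin (f i)) (vf i)

  -- The hypothesis `k ≤ order G` takes care of the default value in `minDegree`.
  ≤degree⇒≤minDegree : k ≤ order G → (∀ v → k ≤ degree G v) → k ≤ minDegree G
  ≤degree⇒≤minDegree k≤n h = v≤min⁺ k≤n (All.map⁺ (All.universal h (allFin (order G))))

  minDegree≤degree : ∀ v → minDegree G ≤ degree G v
  minDegree≤degree v = All.lookup (min≤xs (order G) (map (degree G) (allFin (order G))))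
    (∈-map⁺ (degree G) (∈-allFin v))

-- The handshaking lemma

open Sum′ ℕ.+-0-commutativeMonoid using (sum; sum-cong-≗; ∑-comm; ∑-distrib-+)

indicator : ∀ {p} {P : Set p} → Dec P → ℕ
indicator P? = if does P? then 1 else 0

length-filter-tabulate : ∀ {A : Set} {P : Pred A 0ℓ} (P? : Decidable P) (f : Fin n → A) →
                         length (filter P? (tabulate f)) ≡ sum (indicator ∘ P? ∘ f)
length-filter-tabulate {zero}  P? f = refl
length-filter-tabulate {suc n} P? f with does (P? (f zero))
... | true  = cong suc (length-filter-tabulate P? (f ∘ suc))
... | false = length-filter-tabulate P? (f ∘ suc)

length-filter-map : ∀ {A B : Set} {P : Pred B 0ℓ} (P? : Decidable P) (f : A → B) xs →
                    length (filter P? (map f xs)) ≡ length (filter (P? ∘ f) xs)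
length-filter-map P? f []       = refl
length-filter-map P? f (x ∷ xs) with does (P? (f x))
... | true  = cong suc (length-filter-map P? f xs)
... | false = length-filter-map P? f xs

length-filter-cartesianProduct :
  ∀ {A B : Set} {P : Pred (A × B) 0ℓ} (P? : Decidable P) (f : Fin n → A) ys →
  length (filter P? (cartesianProduct (tabulate f) ys)) ≡
  sum (λ i → length (filter (λ y → P? (f i , y)) ys))
length-filter-cartesianProduct {zero}  P? f ys = refl
length-filter-cartesianProduct {suc n} P? f ys = begin
  length (filter P? (row ++ rest))
    ≡⟨ cong length (filter-++ P? row rest) ⟩
  length (filter P? row ++ filter P? rest)
    ≡⟨ length-++ (filter P? row) ⟩
  length (filter P? row) + length (filter P? rest)
    ≡⟨ cong₂ _+_ (length-filter-map P? (f zero ,_) ys) (length-filter-cartesianProduct P? (f ∘ suc) ys) ⟩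
  sum (λ i → length (filter (λ y → P? (f i , y)) ys)) ∎
  where
  open ≡-Reasoning
  row  = map (f zero ,_) ys
  rest = cartesianProduct (tabulate (f ∘ suc)) ys

indicator-yes : ∀ {p} {P : Set p} (P? : Dec P) → P → indicator P? ≡ 1
indicator-yes P? p = cong (if_then 1 else 0) (dec-true P? p)

indicator-no : ∀ {p} {P : Set p} (P? : Dec P) → ¬ P → indicator P? ≡ 0
indicator-no P? ¬p = cong (if_then 1 else 0) (dec-false P? ¬p)

module _ (G : Graph) where

  private
    N = order G
    arc? : ∀ u v → Dec (u Fin.< v × Adj G u v)
    arc? u v = isEdge? G (u , v)

  adj-orientation : ∀ u v → indicator (adj? G u v) ≡ indicator (arc? u v) + indicator (arc? v u)
  adj-orientation u v = orient (adj? G u v) (<-cmp u v)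
    where
    yes-arc : ∀ {u v} → u Fin.< v → Adj G u v → indicator (arc? u v) ≡ 1
    yes-arc u<v uv = indicator-yes (arc? _ _) (u<v , uv)

    no-arc : ∀ {u v} → ¬ (u Fin.< v × Adj G u v) → indicator (arc? u v) ≡ 0
    no-arc = indicator-no (arc? _ _)

    orient : Dec (Adj G u v) → Tri (u Fin.< v) (u ≡ v) (v Fin.< u) →
             indicator (adj? G u v) ≡ indicator (arc? u v) + indicator (arc? v u)
    orient (no ¬uv) _ = trans (indicator-no (adj? G u v) ¬uv)
      (sym (cong₂ _+_ (no-arc (¬uv ∘ proj₂)) (no-arc (¬uv ∘ adj-sym G ∘ proj₂))))
    orient (yes uv) (tri< u<v _ v≮u) = trans (indicator-yes (adj? G u v) uv)
      (sym (cong₂ _+_ (yes-arc u<v uv) (no-arc (v≮u ∘ proj₁))))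
    orient (yes uv) (tri≈ _ u≡v _)   = contradiction uv (adj-irrefl G u≡v)
    orient (yes uv) (tri> u≮v _ v<u) = trans (indicator-yes (adj? G u v) uv)
      (sym (cong₂ _+_ (no-arc (u≮v ∘ proj₁)) (yes-arc v<u (adj-sym G uv))))

  length-edges : length (edges G) ≡ sum (λ u → sum (λ v → indicator (arc? u v)))
  length-edges = trans (length-filter-cartesianProduct (isEdge? G) id (allFin N))
    (sum-cong-≗ λ u → length-filter-tabulate (arc? u) id)

  -- Each degree splits into arcs to larger and arcs from smaller vertices; exchanging the order of
  -- summation turns the second total into the first.
  handshake : sum (degree G) ≡ 2 * length (edges G)
  handshake = begin
    sum (degree G)
      ≡⟨ sum-cong-≗ (λ u → trans (length-filter-tabulate (adj? G u) id) (sum-cong-≗ (adj-orientation u))) ⟩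
    sum (λ u → sum (λ v → out u v + out v u))
      ≡⟨ sum-cong-≗ (λ u → ∑-distrib-+ (out u) (flip out u)) ⟩
    sum (λ u → sum (out u) + sum (flip out u))
      ≡⟨ ∑-distrib-+ (sum ∘ out) (sum ∘ flip out) ⟩
    sum (sum ∘ out) + sum (sum ∘ flip out)
      ≡⟨ cong₂ _+_ (sym length-edges) (trans (∑-comm (flip out)) (sym length-edges)) ⟩
    length (edges G) + length (edges G)
      ≡⟨ cong (λ e → length (edges G) + e) (sym (ℕ.+-identityʳ _)) ⟩
    2 * length (edges G) ∎
    where
    open ≡-Reasoning
    out : Vertex G → Vertex G → ℕ
    out u v = indicator (arc? u v)

sum-≥ : ∀ {c} (f : Fin n → ℕ) → (∀ i → c ≤ f i) → n * c ≤ sum f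
sum-≥ {zero}  f h = z≤n
sum-≥ {suc n} f h = ℕ.+-mono-≤ (h zero) (sum-≥ (f ∘ suc) (h ∘ suc))

-- This gives δ(G) ≤ d(G), so that one lower bound on the minimum degree serves all four
-- inequalities.
order*minDegree≤2*edges : ∀ G → order G * minDegree G ≤ 2 * length (edges G)
order*minDegree≤2*edges G = subst (order G * minDegree G ≤_) (handshake G)
  (sum-≥ (degree G) (minDegree≤degree G))

-- The counterexample

bandGraph : ℕ → ℕ → Graph
bandGraph m K = record
  { order      = K * K
  ; Adj        = λ x y → x ≢ y × (∣ toℕ x - toℕ y ∣ ≤ m ⊎ ∣ toℕ x - toℕ y ∣ ≡ K)
  ; adj?       = λ x y → ¬? (x ≟ y) ×-dec ((∣ toℕ x - toℕ y ∣ ℕ.≤? m) ⊎-dec (∣ toℕ x - toℕ y ∣ ℕ.≟ K))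
  ; adj-sym    = λ {x} {y} (x≢y , near) → x≢y ∘ sym ,
      subst (λ d → d ≤ m ⊎ d ≡ K) (ℕ.∣-∣-comm (toℕ x) (toℕ y)) near
  ; adj-irrefl = λ x≡y (x≢y , _) → x≢y x≡y
  }

module _ {m K : ℕ} where

  private
    G = bandGraph m K

  band-adj : ∀ {x y : Vertex G} d → toℕ y ≡ toℕ x + suc d → suc d ≤ m ⊎ suc d ≡ K → Adj G x y
  band-adj {x} {y} d y≡x+d near =
    (λ { refl → ℕ.m≢1+m+n (toℕ x) (trans y≡x+d (ℕ.+-suc (toℕ x) d)) }) ,
    subst (λ d → d ≤ m ⊎ d ≡ K)
      (sym (trans (cong (λ y → ∣ toℕ x - y ∣) y≡x+d) (ℕ.∣m-m+n∣≡n (toℕ x) (suc d)))) near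

  row-step : 1 ≤ m → ∀ (i a b : Fin K) → toℕ b ≡ suc (toℕ a) → Adj G (combine i a) (combine i b)
  row-step 1≤m i a b b≡1+a = band-adj 0 (begin
    toℕ (combine i b)         ≡⟨ toℕ-combine i b ⟩
    K * toℕ i + toℕ b         ≡⟨ cong (λ a → K * toℕ i + a) (trans b≡1+a (ℕ.+-comm 1 (toℕ a))) ⟩
    K * toℕ i + (toℕ a + 1)   ≡⟨ ℕ.+-assoc (K * toℕ i) (toℕ a) 1 ⟨
    (K * toℕ i + toℕ a) + 1   ≡⟨ cong (_+ 1) (toℕ-combine i a) ⟨
    toℕ (combine i a) + 1     ∎) (inj₁ 1≤m)
    where open ≡-Reasoning

  band-hasEdge : 1 ≤ m → 2 ≤ K → HasEdge G
  band-hasEdge 1≤m (s≤s (s≤s _)) = _ , _ , row-step 1≤m zero zero (suc zero) refl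

-- Crosses and the treewidth of the band graph

module _ {m K : ℕ} (1≤m : 1 ≤ m) where

  private
    G = bandGraph m K

  -- Passing to the next row adds `K` to `K * i + j`, a long edge. The equation for `K` puts this
  -- difference into the form `suc d` of `band-adj`.
  column-step : ∀ {K′} → K ≡ suc K′ → ∀ (j a b : Fin K) → toℕ b ≡ suc (toℕ a) → Adj G (combine a j) (combine b j)
  column-step {K′} refl j a b b≡1+a = band-adj K′ (begin
    toℕ (combine b j)         ≡⟨ toℕ-combine b j ⟩
    K * toℕ b + toℕ j         ≡⟨ cong (λ b → K * b + toℕ j) b≡1+a ⟩
    K * suc (toℕ a) + toℕ j   ≡⟨ cong (λ a → a + toℕ j) (ℕ.*-suc K (toℕ a)) ⟩
    K + K * toℕ a + toℕ j     ≡⟨ ℕ.+-assoc K (K * toℕ a) (toℕ j) ⟩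
    K + (K * toℕ a + toℕ j)   ≡⟨ ℕ.+-comm K _ ⟩
    (K * toℕ a + toℕ j) + K   ≡⟨ cong (λ a → a + K) (toℕ-combine a j) ⟨
    toℕ (combine a j) + K     ∎) (inj₂ refl)
    where open ≡-Reasoning

  row column : Vertex G → Fin K
  row x    = quotient K x
  column x = remainder {K} K x

  row-combine : ∀ i j → row (combine i j) ≡ i
  row-combine i j = cong proj₁ (remQuot-combine i j)

  column-combine : ∀ i j → column (combine i j) ≡ j
  column-combine i j = cong proj₂ (remQuot-combine {K} i j)

  Cross : Fin K × Fin K → Vertex G → Set
  Cross (i , j) x = row x ≡ i ⊎ column x ≡ j

  cross-connected : ∀ {K′} → K ≡ suc K′ → ∀ c → InducesConnected G (Cross c)
  cross-connected refl (i , j) s t Xs Xt =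
    toCentre s Xs ◅◅ Star.reverse (λ (Xa , Xb , ab) → Xb , Xa , adj-sym G ab) (toCentre t Xt)
    where
    Within : Vertex G → Vertex G → Set
    Within a b = Cross (i , j) a × Cross (i , j) b × Adj G a b

    -- Rows and columns are images of the path on `K` vertices and inherit its connectedness.
    along : (f : Fin K → Vertex G) → (∀ a → Cross (i , j) (f a)) →
            (∀ a b → toℕ b ≡ suc (toℕ a) → Adj G (f a) (f b)) → ∀ a b → Star Within (f a) (f b)
    along f Xf step a b = Star.gmap f
      (λ { (inj₁ up) → Xf _ , Xf _ , step _ _ up
         ; (inj₂ down) → Xf _ , Xf _ , adj-sym G (step _ _ down) })
      (IsTree.connected (pathGraph-isTree K) a b)

    toCentre : ∀ x → Cross (i , j) x → Star Within x (combine i j)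
    toCentre x (inj₁ refl) = subst (λ y → Star Within y (combine i j)) (combine-remQuot {K} K x)
      (along (combine i) (λ a → inj₁ (row-combine i a)) (row-step 1≤m i) (column x) j)
    toCentre x (inj₂ refl) = subst (λ y → Star Within y (combine i j)) (combine-remQuot {K} K x)
      (along (λ a → combine a j) (λ a → inj₂ (column-combine a j)) (column-step refl j) (row x) i)

  -- A bag with at most `K′` vertices misses a whole row and a whole column, hence the cross formed
  -- by them.
  band-width≥ : ∀ {K′} → K ≡ suc K′ → ∀ (D : TreeDecomposition G) → + K′ ℤ.≤ width D
  band-width≥ refl D = ¬∣bag∣≤⇒≤width D λ small →
    pairwiseMeeting⇒hittingBag Cross (cross-connected refl)
      (λ (i , _) (_ , j) → combine i j , inj₁ (row-combine i j) , inj₂ (column-combine i j))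
      D λ t →
        let i , no-row    = missedValue (TreeDecomposition.bag D t) row (s≤s (small t))
            j , no-column = missedValue (TreeDecomposition.bag D t) column (s≤s (small t))
        in (i , j) , λ { v (inj₁ r) v∈t → no-row v∈t r ; v (inj₂ c) v∈t → no-column v∈t c }

-- Degrees of the band graph

module _ {m K : ℕ} (2m≤K² : m + m ≤ K * K) where

  private
    G = bandGraph m K
    N = K * K

  -- The neighbours are the `m` vertices after `v` if these exist, and otherwise the `m` vertices
  -- before `v`; by `2m≤K²` one of the two runs fits.
  band-degree : ∀ v → m ≤ degree G v
  band-degree v with toℕ v + m ℕ.<? N
  ... | yes v+m<N = injection⇒≤degree G v (λ i → fromℕ< (bound i))
    (λ {i} {j} eq → toℕ-injective (ℕ.suc-injective (ℕ.+-cancelˡ-≡ (toℕ v) _ _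
      (fromℕ<-injective _ _ (bound i) (bound j) eq))))
    (λ i → band-adj (toℕ i) (toℕ-fromℕ< (bound i)) (inj₁ (toℕ<n i)))
    where
    bound : ∀ (i : Fin m) → toℕ v + suc (toℕ i) ℕ.< N
    bound i = ℕ.≤-<-trans (ℕ.+-monoʳ-≤ (toℕ v) (toℕ<n i)) v+m<N
  ... | no v+m≮N = injection⇒≤degree G v (λ i → fromℕ< (bound i))
    (λ {i} {j} eq → toℕ-injective (ℕ.suc-injective (ℕ.∸-cancelˡ-≡ (below i) (below j)
      (fromℕ<-injective _ _ (bound i) (bound j) eq))))
    (λ i → adj-sym G {fromℕ< (bound i)} {v} (band-adj (toℕ i)
      (sym (trans (cong (λ a → a + suc (toℕ i)) (toℕ-fromℕ< (bound i))) (ℕ.m∸n+n≡m (below i))))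
      (inj₁ (toℕ<n i))))
    where
    m≤v : m ≤ toℕ v
    m≤v = ℕ.+-cancelʳ-≤ m m (toℕ v) (ℕ.≤-trans 2m≤K² (ℕ.≮⇒≥ v+m≮N))
    below : ∀ (i : Fin m) → suc (toℕ i) ≤ toℕ v
    below i = ℕ.≤-trans (toℕ<n i) m≤v
    bound : ∀ (i : Fin m) → toℕ v ∸ suc (toℕ i) ℕ.< N
    bound i = ℕ.≤-<-trans (ℕ.m∸n≤m (toℕ v) (suc (toℕ i))) (toℕ<n v)

  band-minDegree : m ≤ minDegree G
  band-minDegree = ≤degree⇒≤minDegree G (ℕ.≤-trans (ℕ.m≤m+n m m) 2m≤K²) band-degree

-- Path decomposition of the line graph

module _ {m K : ℕ} .{{_ : NonZero (K * K)}} where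

  private
    G = bandGraph m K
    D = lineGraphDecomposition G
    open TreeDecomposition D using (bag)

  -- The first summand counts pairs of distances from 0 to `m`, for short edges; the second counts
  -- distances from 0 to `K`, for long ones.
  band-lineGraph-∣bag∣≤ : ∀ t → ∣ bag t ∣ ≤ suc m * suc m + suc K
  band-lineGraph-∣bag∣≤ t = injectiveOn⇒∣p∣≤ (bag t)
    (λ e∈ → join (suc m * suc m) (suc K) (code e∈ (near _)))
    λ e∈ f∈ eq → code-injective e∈ f∈ (near _) (near _) (begin
      code e∈ (near _)
        ≡⟨ splitAt-join (suc m * suc m) (suc K) _ ⟨
      splitAt _ (join (suc m * suc m) (suc K) (code e∈ (near _)))
        ≡⟨ cong (splitAt (suc m * suc m)) eq ⟩
      splitAt _ (join (suc m * suc m) (suc K) (code f∈ (near _)))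
        ≡⟨ splitAt-join (suc m * suc m) (suc K) _ ⟩
      code f∈ (near _) ∎)
    where
    open ≡-Reasoning

    s τ : Fin (length (edges G)) → ℕ
    s e = toℕ (source G e)
    τ e = toℕ (target G e)

    p : ℕ
    p = toℕ t

    straddles : ∀ {e} → e ∈ bag t → s e ≤ p × p ≤ τ e
    straddles = lineGraphDecomposition-bag⁻ G {t}

    Near : Fin (length (edges G)) → Set
    Near e = τ e ∸ s e ≤ m ⊎ τ e ∸ s e ≡ K

    near : ∀ e → Near e
    near e = subst (λ d → d ≤ m ⊎ d ≡ K) (ℕ.m≤n⇒∣m-n∣≡n∸m (source≤target G e))
               (proj₂ (proj₂ (edge-valid G e)))

    -- Since `t` lies between the ends of the edge, neither end is farther from `t` than the length
    -- of the edge.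
    left≤ : ∀ {e k} → e ∈ bag t → τ e ∸ s e ≤ k → p ∸ s e ℕ.< suc k
    left≤ {e} e∈ d≤k = s≤s (ℕ.≤-trans (ℕ.∸-monoˡ-≤ (s e) (proj₂ (straddles e∈))) d≤k)

    right≤ : ∀ {e k} → e ∈ bag t → τ e ∸ s e ≤ k → τ e ∸ p ℕ.< suc k
    right≤ {e} e∈ d≤k = s≤s (ℕ.≤-trans (ℕ.∸-monoʳ-≤ (τ e) (proj₁ (straddles e∈))) d≤k)

    -- A short edge is determined by the distances of its ends from t, a long
    -- one by its left end.
    code : ∀ {e} → e ∈ bag t → Near e → Fin (suc m * suc m) ⊎ Fin (suc K)
    code e∈ (inj₁ d≤m) = inj₁ (combine (fromℕ< (left≤ e∈ d≤m)) (fromℕ< (right≤ e∈ d≤m)))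
    code e∈ (inj₂ d≡K) = inj₂ (fromℕ< (left≤ e∈ (ℕ.≤-reflexive d≡K)))

    source-≡ : ∀ {e f} → e ∈ bag t → f ∈ bag t → p ∸ s e ≡ p ∸ s f → source G e ≡ source G f
    source-≡ e∈ f∈ = toℕ-injective ∘ ℕ.∸-cancelˡ-≡ (proj₁ (straddles e∈)) (proj₁ (straddles f∈))

    target-≡ : ∀ {e f} → e ∈ bag t → f ∈ bag t → τ e ∸ p ≡ τ f ∸ p → target G e ≡ target G f
    target-≡ e∈ f∈ = toℕ-injective ∘ ℕ.∸-cancelʳ-≡ (proj₂ (straddles e∈)) (proj₂ (straddles f∈))

    code-injective : ∀ {e f} (e∈ : e ∈ bag t) (f∈ : f ∈ bag t) (ne : Near e) (nf : Near f) →
                     code e∈ ne ≡ code f∈ nf → e ≡ f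
    code-injective e∈ f∈ (inj₁ de) (inj₁ df) eq =
      let left , right = combine-injective _ _ _ _ (inj₁-injective eq) in
      edge-injective G
        (source-≡ e∈ f∈ (fromℕ<-injective _ _ (left≤ e∈ de) (left≤ f∈ df) left))
        (target-≡ e∈ f∈ (fromℕ<-injective _ _ (right≤ e∈ de) (right≤ f∈ df) right))
    -- Long edges all have length `K`, so equal left ends force equal right ends.
    code-injective {e} {f} e∈ f∈ (inj₂ de) (inj₂ df) eq = edge-injective G se≡sf (toℕ-injective (begin
      τ e             ≡⟨ ℕ.m∸n+n≡m (source≤target G e) ⟨
      τ e ∸ s e + s e ≡⟨ cong₂ _+_ (trans de (sym df)) (cong toℕ se≡sf) ⟩
      τ f ∸ s f + s f ≡⟨ ℕ.m∸n+n≡m (source≤target G f) ⟩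
      τ f             ∎))
      where
      se≡sf : source G e ≡ source G f
      se≡sf = source-≡ e∈ f∈ (fromℕ<-injective _ _
        (left≤ e∈ (ℕ.≤-reflexive de)) (left≤ f∈ (ℕ.≤-reflexive df)) (inj₂-injective eq))
    code-injective _ _ (inj₁ _) (inj₂ _) ()
    code-injective _ _ (inj₂ _) (inj₁ _) ()

  -- `suc m * suc m + suc K` computes to the successor of this bound; the successor is absorbed by
  -- the -1 in the width.
  band-lineGraph-width≤ : width D ℤ.≤ + (m + m * suc m + suc K)
  band-lineGraph-width≤ = ∣bag∣≤⇒width≤ D band-lineGraph-∣bag∣≤

-- Arithmetic of the bound

-- `i / suc n` is reduced to lowest terms; the comparisons below pass to unnormalised fractions,
-- where numerator and denominator stay visible.
/-toℚᵘ : ∀ i n → toℚᵘ (i / suc n) ℚᵘ.≃ mkℚᵘ i n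
/-toℚᵘ i n = ℚ.toℚᵘ-fromℚᵘ (mkℚᵘ i n)

/1-mono-≤ : ∀ {i j} → i ℤ.≤ j → i / 1 ℚ.≤ j / 1
/1-mono-≤ {i} {j} i≤j = ℚ.toℚᵘ-cancel-≤ (begin
  toℚᵘ (i / 1) ≃⟨ /-toℚᵘ i 0 ⟩
  mkℚᵘ i 0     ≤⟨ ℚᵘ.*≤* (ℤ.*-monoʳ-≤-nonNeg (+ 1) i≤j) ⟩
  mkℚᵘ j 0     ≃⟨ /-toℚᵘ j 0 ⟨
  toℚᵘ (j / 1) ∎)
  where open ℚᵘ.≤-Reasoning

/1-cancel-≤ : ∀ {i j} → i / 1 ℚ.≤ j / 1 → i ℤ.≤ j
/1-cancel-≤ {i} {j} i≤j = ℤ.*-cancelʳ-≤-pos i j (+ 1) (ℚᵘ.drop-*≤* (begin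
  mkℚᵘ i 0     ≃⟨ /-toℚᵘ i 0 ⟨
  toℚᵘ (i / 1) ≤⟨ ℚ.toℚᵘ-mono-≤ i≤j ⟩
  toℚᵘ (j / 1) ≃⟨ /-toℚᵘ j 0 ⟩
  mkℚᵘ j 0     ∎))
  where open ℚᵘ.≤-Reasoning

/1-homo-* : ∀ a b → (+ a / 1) ℚ.* (+ b / 1) ≡ + (a * b) / 1
/1-homo-* a b = ℚ.toℚᵘ-injective (begin
  toℚᵘ ((+ a / 1) ℚ.* (+ b / 1))         ≈⟨ ℚ.toℚᵘ-homo-* (+ a / 1) (+ b / 1) ⟩
  toℚᵘ (+ a / 1) ℚᵘ.* toℚᵘ (+ b / 1)     ≈⟨ ℚᵘ.*-cong (/-toℚᵘ (+ a) 0) (/-toℚᵘ (+ b) 0) ⟩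
  mkℚᵘ (+ a) 0 ℚᵘ.* mkℚᵘ (+ b) 0         ≈⟨ ℚᵘ.≃-reflexive (cong (λ i → mkℚᵘ i 0) (sym (ℤ.pos-* a b))) ⟩
  mkℚᵘ (+ (a * b)) 0                     ≈⟨ /-toℚᵘ (+ (a * b)) 0 ⟨
  toℚᵘ (+ (a * b) / 1)                   ∎)
  where open ℚᵘ.≃-Reasoning

/1≤/ : ∀ a b n .{{_ : NonZero n}} → n * a ≤ b → + a / 1 ℚ.≤ + b / n
/1≤/ a b n@(suc n-1) na≤b = ℚ.toℚᵘ-cancel-≤ (begin
  toℚᵘ (+ a / 1) ≃⟨ /-toℚᵘ (+ a) 0 ⟩
  mkℚᵘ (+ a) 0   ≤⟨ ℚᵘ.*≤* (subst₂ ℤ._≤_ (ℤ.pos-* a n) (ℤ.pos-* b 1)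
                      (+≤+ (subst₂ _≤_ (ℕ.*-comm n a) (sym (ℕ.*-identityʳ b)) na≤b))) ⟩
  mkℚᵘ (+ b) n-1 ≃⟨ /-toℚᵘ (+ b) n-1 ⟨
  toℚᵘ (+ b / n) ∎)
  where open ℚᵘ.≤-Reasoning

minDegree≤averageDegree : ∀ G .{{_ : NonZero (order G)}} → + minDegree G / 1 ℚ.≤ averageDegree G
minDegree≤averageDegree G = /1≤/ (minDegree G) (2 * length (edges G)) (order G) (order*minDegree≤2*edges G)

-- The denominator of `c` serves as `q`: then `q c` is the numerator, a positive integer.
positive-multiple≥1 : ∀ c → 0ℚ < c → ∃[ q ] (1ℚ ℚ.≤ (+ q / 1) ℚ.* c)
positive-multiple≥1 c@(mkℚ (+ zero) d cop) (ℚ.*<* (ℤ.+<+ ()))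
positive-multiple≥1 c@(mkℚ (+ suc p) d cop) 0<c = suc d , ℚ.toℚᵘ-cancel-≤ (begin
  mkℚᵘ (+ 1) 0                              ≤⟨ ℚᵘ.*≤* (+≤+ bound) ⟩
  mkℚᵘ (+ suc d) 0 ℚᵘ.* mkℚᵘ (+ suc p) d    ≃⟨ ℚᵘ.*-congʳ {mkℚᵘ (+ suc p) d} (/-toℚᵘ (+ suc d) 0) ⟨
  toℚᵘ (+ suc d / 1) ℚᵘ.* toℚᵘ c            ≃⟨ ℚ.toℚᵘ-homo-* (+ suc d / 1) c ⟨
  toℚᵘ ((+ suc d / 1) ℚ.* c)                ∎)
  where
  open ℚᵘ.≤-Reasoning
  bound : 1 * (1 * suc d) ≤ suc d * suc p * 1
  bound = subst₂ _≤_ (sym (trans (ℕ.*-identityˡ _) (ℕ.*-identityˡ _)))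
            (sym (ℕ.*-identityʳ _)) (ℕ.m≤m*n (suc d) (suc p))

-- Multiplying the supposed inequality by `q` removes `c`: a m ≤ w d ≤ q c w d ≤ q wL ≤ q b, which
-- compares natural numbers only.
product-bound : ∀ {c d w wL} q b a m → 1ℚ ℚ.≤ (+ q / 1) ℚ.* c →
                + a ℤ.≤ w → + m / 1 ℚ.≤ d → wL ℤ.≤ + b →
                c ℚ.* (w / 1) ℚ.* d ℚ.≤ wL / 1 → a * m ≤ q * b
product-bound {c} {d} {w} {wL} q b a m 1≤qc a≤w m≤d wL≤b h = ℤ.drop‿+≤+ (/1-cancel-≤ (begin
  + (a * m) / 1                        ≡⟨ /1-homo-* a m ⟨
  A ℚ.* M                              ≤⟨ ℚ.*-monoʳ-≤-nonNeg M (/1-mono-≤ a≤w) ⟩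
  W ℚ.* M                              ≤⟨ ℚ.*-monoˡ-≤-nonNeg W m≤d ⟩
  W ℚ.* d                              ≡⟨ ℚ.*-identityˡ _ ⟨
  1ℚ ℚ.* (W ℚ.* d)                     ≤⟨ ℚ.*-monoʳ-≤-nonNeg (W ℚ.* d) 1≤qc ⟩
  (Q ℚ.* c) ℚ.* (W ℚ.* d)              ≡⟨ ℚ.*-assoc Q c _ ⟩
  Q ℚ.* (c ℚ.* (W ℚ.* d))              ≡⟨ cong (Q ℚ.*_) (ℚ.*-assoc c W d) ⟨
  Q ℚ.* (c ℚ.* W ℚ.* d)                ≤⟨ ℚ.*-monoˡ-≤-nonNeg Q (ℚ.≤-trans h (/1-mono-≤ wL≤b)) ⟩
  Q ℚ.* (+ b / 1)                      ≡⟨ /1-homo-* q b ⟩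
  + (q * b) / 1                        ∎))
  where
  open ℚ.≤-Reasoning
  A = + a / 1
  M = + m / 1
  W = w / 1
  Q = + q / 1
  nonNeg : ∀ n {r} → + n / 1 ℚ.≤ r → ℚ.NonNegative r
  nonNeg n n≤r = ℚ.nonNegative (ℚ.≤-trans (/1-mono-≤ {+ 0} {+ n} (+≤+ z≤n)) n≤r)
  instance
    _ = nonNeg m {M} ℚ.≤-refl
    _ = nonNeg q {Q} ℚ.≤-refl
    _ = nonNeg a {W} (/1-mono-≤ a≤w)
    Wd≥0 : ℚ.NonNegative (W ℚ.* d)
    Wd≥0 = ℚ.nonNeg*nonNeg⇒nonNeg W d {{nonNeg m m≤d}}

-- From width estimates to the failure of the bounds

module _ {c : ℚ} {q a b m : ℕ} (1≤qc : 1ℚ ℚ.≤ (+ q / 1) ℚ.* c) (gap : ¬ (a * m ≤ q * b))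
         {G : Graph} (lower : ∀ (D : TreeDecomposition G) → + a ℤ.≤ width D)
         (D : TreeDecomposition (lineGraph G)) (upper : width D ℤ.≤ + b)
         {d : ℚ} (m≤d : + m / 1 ℚ.≤ d) where

  private
    ¬lineGraphBound : (IsWidth : Graph → ℤ → Set₁) → (∀ H → ¬ ¬ (Σ[ w ∈ ℤ ] IsWidth H w)) →
                      (∀ {w} → IsWidth G w → + a ℤ.≤ w) →
                      (∀ {wL} → IsWidth (lineGraph G) wL → wL ℤ.≤ + b) →
                      ¬ LineGraphBound IsWidth c G d
    ¬lineGraphBound _ ¬¬exists a≤ ≤b bound =
      ¬¬exists G λ (w , isW) → ¬¬exists (lineGraph G) λ (wL , isWL) →
      gap (product-bound {c} {d} q b a m 1≤qc (a≤ isW) m≤d (≤b isWL) (bound w wL isW isWL))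

  ¬treewidthBound : ¬ LineGraphBound IsTreewidth c G d
  ¬treewidthBound = ¬lineGraphBound IsTreewidth ¬¬-treewidth
    (λ { ((D , refl) , _) → lower D })
    (λ (_ , least) → ℤ.≤-trans (least D) upper)

  -- `lower` holds for all tree decompositions of `G`, in particular for those along a path, and `D`
  -- is itself one along a path.
  ¬pathwidthBound : IsPath (tree D) → ¬ LineGraphBound IsPathwidth c G d
  ¬pathwidthBound path = ¬lineGraphBound IsPathwidth ¬¬-pathwidth
    (λ { ((D , _ , refl) , _) → lower D })
    (λ (_ , least) → ℤ.≤-trans (least D path) upper)

-- K stays a variable and its value is given by an equation: for K of the
-- form suc …, comparing types would make Agda evaluate the degrees of the
-- graph.
module _ {c : ℚ} {q m a K : ℕ} (K≡1+a : K ≡ suc a) (1≤qc : 1ℚ ℚ.≤ (+ q / 1) ℚ.* c)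
         (1≤m : 1 ≤ m) (1≤a : 1 ≤ a) (2m≤K² : m + m ≤ K * K)
         (gap : ¬ (a * m ≤ q * (m + m * suc m + suc K))) where

  private
    G = bandGraph m K
    b : ℕ
    b = m + m * suc m + suc K

    hasEdge : HasEdge G
    hasEdge = band-hasEdge 1≤m (subst (2 ≤_) (sym K≡1+a) (s≤s 1≤a))

    instance
      K²≢0 : NonZero (K * K)
      K²≢0 = nonZeroIndex (proj₁ hasEdge)

    D : TreeDecomposition (lineGraph G)
    D = lineGraphDecomposition G

    m≤minDegree : + m / 1 ℚ.≤ + minDegree G / 1
    m≤minDegree = /1-mono-≤ {+ m} {+ minDegree G} (+≤+ (band-minDegree {m} {K} 2m≤K²))

    m≤averageDegree : + m / 1 ℚ.≤ averageDegree G
    m≤averageDegree = ℚ.≤-trans m≤minDegree (minDegree≤averageDegree G)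

    lower : ∀ (D : TreeDecomposition G) → + a ℤ.≤ width D
    lower = band-width≥ 1≤m K≡1+a

    upper : width D ℤ.≤ + b
    upper = band-lineGraph-width≤ {m} {K}

  band-counterexample :
      (Σ[ G ∈ Graph ] (HasEdge G × ¬ LineGraphBound IsTreewidth c G (+ minDegree G / 1)))
    × (Σ[ G ∈ Graph ] Σ[ e ∈ HasEdge G ] ¬ LineGraphBound IsTreewidth c G (averageDegree G {{nonZeroIndex (proj₁ e)}}))
    × (Σ[ G ∈ Graph ] (HasEdge G × ¬ LineGraphBound IsPathwidth c G (+ minDegree G / 1)))
    × (Σ[ G ∈ Graph ] Σ[ e ∈ HasEdge G ] ¬ LineGraphBound IsPathwidth c G (averageDegree G {{nonZeroIndex (proj₁ e)}}))
  band-counterexample =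
      (G , hasEdge , ¬treewidthBound {q = q} {a} {b} {m} 1≤qc gap lower D upper m≤minDegree)
    , (G , hasEdge , ¬treewidthBound {q = q} {a} {b} {m} 1≤qc gap lower D upper m≤averageDegree)
    , (G , hasEdge , ¬pathwidthBound {q = q} {a} {b} {m} 1≤qc gap lower D upper m≤minDegree (pathGraph-isPath (order G)))
    , (G , hasEdge , ¬pathwidthBound {q = q} {a} {b} {m} 1≤qc gap lower D upper m≤averageDegree (pathGraph-isPath (order G)))

-- Choice of the parameters

module _ (q : ℕ) where

  private
    r m b : ℕ
    r = 6 * q
    m = suc r
    b = m + m * suc m + suc (suc (m * m))

  -- Here b = 2m² + 2m + 2 ≤ 6m² because m ≥ 1, and m = 6q + 1 gives 6q m² < m³. The term
  -- `4 * (r * r) + 6 * r` is the difference 6m² - b, written in r = m - 1.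
  width-gap : ¬ (m * m * m ≤ q * b)
  width-gap = ℕ.<⇒≱ (begin-strict
    q * b             ≤⟨ ℕ.*-monoʳ-≤ q (subst (b ≤_) (expand r) (ℕ.m≤m+n b (4 * (r * r) + 6 * r))) ⟩
    q * (6 * (m * m)) ≡⟨ regroup q (m * m) ⟩
    m * m * r         <⟨ ℕ.*-monoʳ-< (m * m) (ℕ.n<1+n r) ⟩
    m * m * m         ∎)
    where
    open ℕ.≤-Reasoning
    expand : ∀ r → (suc r + suc r * suc (suc r) + suc (suc (suc r * suc r))) + (4 * (r * r) + 6 * r)
                   ≡ 6 * (suc r * suc r)
    expand = solve-∀
    regroup : ∀ q s → q * (6 * s) ≡ s * (6 * q)
    regroup = solve-∀

-- In terms of r = m - 1 the difference of the two sides is a polynomial with nonnegative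
-- coefficients, so it can be added explicitly.
2m≤[1+m²]² : ∀ m → m + m ≤ suc (m * m) * suc (m * m)
2m≤[1+m²]² zero    = z≤n
2m≤[1+m²]² m@(suc r) = subst (m + m ≤_) (expand r)
  (ℕ.m≤m+n (m + m) (r * r * r * r + 4 * (r * r * r) + 8 * (r * r) + 6 * r + 2))
  where
  expand : ∀ r → (suc r + suc r) + (r * r * r * r + 4 * (r * r * r) + 8 * (r * r) + 6 * r + 2)
                 ≡ suc (suc r * suc r) * suc (suc r * suc r)
  expand = solve-∀

mainTheorem7 : ∀ (c : ℚ) → 0ℚ < c →
    (Σ[ G ∈ Graph ] (HasEdge G × ¬ LineGraphBound IsTreewidth c G (+ minDegree G / 1)))
    × (Σ[ G ∈ Graph ] Σ[ e ∈ HasEdge G ] ¬ LineGraphBound IsTreewidth c G (averageDegree G {{nonZeroIndex (proj₁ e)}}))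
    × (Σ[ G ∈ Graph ] (HasEdge G × ¬ LineGraphBound IsPathwidth c G (+ minDegree G / 1)))
    × (Σ[ G ∈ Graph ] Σ[ e ∈ HasEdge G ] ¬ LineGraphBound IsPathwidth c G (averageDegree G {{nonZeroIndex (proj₁ e)}}))
mainTheorem7 c 0<c =
  let q , 1≤qc = positive-multiple≥1 c 0<c
      m : ℕ
      m = suc (6 * q)
  -- With K = m² + 1 the treewidth bound K - 1 is m², while the at most K + 1 long edges in a bag
  -- stay of the same order as the (m + 1)² short ones.
  in band-counterexample {c} {q} {m} {m * m} {suc (m * m)} refl 1≤qc
       (s≤s z≤n) (s≤s z≤n) (2m≤[1+m²]² m) (width-gap q)
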